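{- Let $K_{m_1,m_2}$ be the complete bipartite graph with bipartition $(X,Y)$, $|X|=m_1$, $|Y|=m_2$, where $2\le m_1\le m_2$. If $S\subseteq X$ and $|S|\ge 2$, then $\kappa^*_{K_{m_1,m_2}}(S)=m_2$. If $S\subseteq Y$ and $|S|\ge 2$, then $\kappa^*_{K_{m_1,m_2}}(S)=m_1$.
   Context: For $S\subseteq V(G)$ with $|S|\ge 2$, an $S$-Steiner tree of $G$ is a subtree $T$ of $G$ with $S\subseteq V(T)$ all of whose leaves belong to $S$. A family of $S$-Steiner trees $T_1,\dots,T_k$ is completely independent if for all $1\le p<q\le k$: $E(T_p)\cap E(T_q)=\emptyset$, $V(T_p)\cap V(T_q)=S$, and for any two vertices $x_1,x_2\in S$ the $(x_1,x_2)$-paths in $T_p$ and in $T_q$ are internally disjoint. $\kappa^*_G(S)$ is the maximum number of trees in a completely independent family of $S$-Steiner trees in $G$. -}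

module Defs where

open import Level using (0ℓ)
open import Data.Nat using (ℕ; _≤_)
open import Data.Fin using (Fin; _<_)
open import Data.Fin.Subset using (Subset; _∈_; _∉_; _⊆_; _∩_; ∣_∣; Nonempty)
open import Data.List using (List; []; _∷_; length)
open import Data.List.Membership.Propositional using () renaming (_∈_ to _∈ˡ_)
open import Data.List.Relation.Unary.Unique.Propositional using (Unique)
open import Data.Product using (Σ; _×_)
open import Data.Sum using (_⊎_)
open import Data.Vec using (tabulate)
open import Relation.Binary using (Rel; Symmetric; Irreflexive; Decidable)
open import Relation.Binary.Construct.Closure.ReflexiveTransitive using (Star; ε; _◅_)
open import Relation.Binary.PropositionalEquality using (_≡_; _≢_)
open import Relation.Nullary using (¬_; does)

record Graph (n : ℕ) : Set₁ where
  field
    Adj    : Rel (Fin n) 0ℓ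
    sym    : Symmetric Adj
    irrefl : Irreflexive _≡_ Adj
    adj?   : Decidable Adj

record IsCompleteBipartite {n} (G : Graph n) (X Y : Subset n) : Set where
  open Graph G
  field
    cover        : ∀ v → v ∈ X ⊎ v ∈ Y
    disjoint     : ∀ {v} → v ∈ X → v ∉ Y
    independentX : ∀ {u v} → u ∈ X → v ∈ X → ¬ Adj u v
    independentY : ∀ {u v} → u ∈ Y → v ∈ Y → ¬ Adj u v
    complete     : ∀ {u v} → u ∈ X → v ∈ Y → Adj u v

-- Not necessarily induced or spanning; the edge uv is in E(H) iff E u v.
record Subgraph {n} (G : Graph n) : Set₁ where
  field
    V     : Subset n
    E     : Rel (Fin n) 0ℓ
    E-sym : Symmetric E
    E?    : Decidable E
    E⇒Adj : ∀ {u v} → E u v → Graph.Adj G u v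
    E⇒V   : ∀ {u v} → E u v → u ∈ V

vertices : ∀ {n} {R : Rel (Fin n) 0ℓ} {u v} → Star R u v → List (Fin n)
vertices {u = u} ε       = u ∷ []
vertices {u = u} (_ ◅ w) = u ∷ vertices w

record Path {n} (R : Rel (Fin n) 0ℓ) (u v : Fin n) : Set where
  field
    walk   : Star R u v
    simple : Unique (vertices walk)

pathVertices : ∀ {n} {R : Rel (Fin n) 0ℓ} {u v} → Path R u v → List (Fin n)
pathVertices P = vertices (Path.walk P)

InternallyDisjoint : ∀ {n} {R R′ : Rel (Fin n) 0ℓ} {u v} → Path R u v → Path R′ u v → Set
InternallyDisjoint {u = u} {v} P Q =
  ∀ {w} → w ∈ˡ pathVertices P → w ∈ˡ pathVertices Q → w ≡ u ⊎ w ≡ v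

module _ {n} {G : Graph n} (H : Subgraph G) where
  open Subgraph H

  Connected : Set
  Connected = ∀ {u v} → u ∈ V → v ∈ V → Path E u v

  -- A cycle is a path on at least three vertices together with an edge
  -- joining its last vertex to its first.
  Acyclic : Set
  Acyclic = ∀ {u v} (P : Path E u v) → 3 ≤ length (pathVertices P) → ¬ E v u

  neighbours : Fin n → Subset n
  neighbours v = tabulate (λ w → does (E? v w))

  degree : Fin n → ℕ
  degree v = ∣ neighbours v ∣

  IsLeaf : Fin n → Set
  IsLeaf v = v ∈ V × degree v ≡ 1

  record IsTree : Set where
    field
      nonempty  : Nonempty V
      connected : Connected
      acyclic   : Acyclic

record SteinerTree {n} (G : Graph n) (S : Subset n) : Set₁ where
  field
    tree     : Subgraph G
    isTree   : IsTree tree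
    spans    : S ⊆ Subgraph.V tree
    leaves⊆S : ∀ {v} → IsLeaf tree v → v ∈ S
  open Subgraph tree public

module _ {n} {G : Graph n} {S : Subset n} where
  open SteinerTree

  -- Paths between two vertices of a tree are unique, so quantifying over all
  -- (x₁,x₂)-paths in each tree speaks of the (x₁,x₂)-path in each tree.
  record CompletelyIndependent {k} (T : Fin k → SteinerTree G S) : Set where
    field
      edgeDisjoint : ∀ {p q} → p < q → ∀ {u v} → ¬ (E (T p) u v × E (T q) u v)
      meetInS      : ∀ {p q} → p < q → V (T p) ∩ V (T q) ≡ S
      pathDisjoint : ∀ {p q} → p < q → ∀ {x₁ x₂} → x₁ ∈ S → x₂ ∈ S → x₁ ≢ x₂ →
                     (P : Path (E (T p)) x₁ x₂) (Q : Path (E (T q)) x₁ x₂) →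
                     InternallyDisjoint P Q

HasIndependentFamily : ∀ {n} → Graph n → Subset n → ℕ → Set₁
HasIndependentFamily G S k =
  Σ (Fin k → SteinerTree G S) CompletelyIndependent

-- The maximum is a relation, not a function: κ*[ G , S ]≡ k says that it is k.
record κ*[_,_]≡_ {n} (G : Graph n) (S : Subset n) (k : ℕ) : Set₁ where
  field
    attained : HasIndependentFamily G S k
    maximal  : ∀ {j} → HasIndependentFamily G S j → j ≤ k

{-# OPTIONS --safe #-}
-- Let S lie in one part X of the bipartition.  The stars with leaf set S and
-- centre y, for y in the other part Y, form a completely independent family.
-- Conversely, fix distinct x, x′ ∈ S: every S-Steiner tree contains a first edge
-- xy of its (x,x′)-path, where y ∈ Y, and edge-disjointness makes these y distinct.
module Submission where

open import Level using (0ℓ)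
open import Data.Nat using (ℕ; _≤_; s≤s)
open import Data.Nat.Properties using (≤-trans)
open import Data.Fin using (Fin; zero; suc; _<_; _≟_; inject≤)
open import Data.Fin.Properties using (<-cmp; <⇒≢; suc-injective; inject≤-injective; injective⇒≤)
open import Data.Fin.Subset using (Subset; inside; outside; _∈_; _∉_; _⊆_; _∩_; _∪_; ⁅_⁆; ∣_∣)
open import Data.Fin.Subset.Properties
  using (_∈?_; p⊆q⇒∣p∣≤∣q∣; ⊆-antisym; p⊆p∪q; q⊆p∪q; x∈p∪q⁻; x∈p∩q⁺; x∈p∩q⁻; x∈⁅x⁆; x∈⁅y⁆⇒x≡y)
open import Data.List using (length)
open import Data.List.Membership.Propositional using () renaming (_∈_ to _∈ˡ_)
open import Data.List.Relation.Unary.All as All using ([]; _∷_)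
open import Data.List.Relation.Unary.AllPairs using ([]; _∷_)
open import Data.List.Relation.Unary.Any using (here; there)
open import Data.Product using (_×_; _,_; proj₁; proj₂; ∃-syntax)
open import Data.Sum using (_⊎_; inj₁; inj₂; swap)
open import Data.Vec using ([]; _∷_; here; there)
open import Data.Vec.Properties using (lookup⇒[]=; lookup∘tabulate)
open import Function using (_∘_)
open import Function.Definitions using (Injective)
open import Relation.Binary using (Rel; Symmetric; Decidable; tri<; tri≈; tri>)
open import Relation.Binary.Construct.Closure.ReflexiveTransitive using (Star; ε; _◅_)
open import Relation.Binary.PropositionalEquality using (_≡_; _≢_; refl; sym; trans; cong; subst)
open import Relation.Nullary using (¬_; yes; no; contradiction)
open import Relation.Nullary.Decidable using (dec-true; map′; _×-dec_; _⊎-dec_)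
open import Defs

private variable
  n : ℕ

-- Enumeration of a finite subset.

element : (p : Subset n) → Fin ∣ p ∣ → Fin n
element (inside  ∷ p) zero    = zero
element (inside  ∷ p) (suc i) = suc (element p i)
element (outside ∷ p) i       = suc (element p i)

element∈ : (p : Subset n) (i : Fin ∣ p ∣) → element p i ∈ p
element∈ (inside  ∷ p) zero    = here
element∈ (inside  ∷ p) (suc i) = there (element∈ p i)
element∈ (outside ∷ p) i       = there (element∈ p i)

element-injective : (p : Subset n) → Injective _≡_ _≡_ (element p)
element-injective (inside  ∷ p) {zero}  {zero}  eq = refl
element-injective (inside  ∷ p) {suc i} {suc j} eq =
  cong suc (element-injective p (suc-injective eq))
element-injective (outside ∷ p) eq = element-injective p (suc-injective eq)

-- Position in the increasing enumeration `element p`, read off the membership proof. It carries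
-- maps into `p` over to `Fin ∣ p ∣`, where pigeonhole applies.
rank : {p : Subset n} {x : Fin n} → x ∈ p → Fin ∣ p ∣
rank {p = inside  ∷ p} here      = zero
rank {p = inside  ∷ p} (there m) = suc (rank m)
rank {p = outside ∷ p} (there m) = rank m

element-rank : {p : Subset n} {x : Fin n} (m : x ∈ p) → element p (rank m) ≡ x
element-rank {p = inside  ∷ p} here      = refl
element-rank {p = inside  ∷ p} (there m) = cong suc (element-rank m)
element-rank {p = outside ∷ p} (there m) = cong suc (element-rank m)

injective-into⇒≤ : ∀ {j} {p : Subset n} (f : Fin j → Fin n) → Injective _≡_ _≡_ f →
                   (∀ i → f i ∈ p) → j ≤ ∣ p ∣
injective-into⇒≤ {p = p} f f-inj f∈p = injective⇒≤ {f = rank ∘ f∈p} λ {i} {i′} eq →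
  f-inj (trans (sym (element-rank (f∈p i))) (trans (cong (element p) eq) (element-rank (f∈p i′))))

2≤⇒distinct-pair : {p : Subset n} → 2 ≤ ∣ p ∣ → ∃[ x ] ∃[ y ] (x ∈ p × y ∈ p × x ≢ y)
2≤⇒distinct-pair {p = p} 2≤ = element p i , element p j , element∈ p i , element∈ p j , distinct
  where
  i = inject≤ zero 2≤
  j = inject≤ (suc zero) 2≤
  distinct : element p i ≢ element p j
  -- Both maps are injective, so `eq` reduces to the absurd `zero ≡ suc zero`.
  distinct eq with () ← inject≤-injective 2≤ 2≤ _ _ (element-injective p eq)

-- Walks and stars.

module _ {R : Rel (Fin n) 0ℓ} where

  source∈vertices : ∀ {u v} (w : Star R u v) → u ∈ˡ vertices w
  source∈vertices ε       = here refl
  source∈vertices (_ ◅ _) = here refl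

  target∈vertices : ∀ {u v} (w : Star R u v) → v ∈ˡ vertices w
  target∈vertices ε       = here refl
  target∈vertices (_ ◅ w) = there (target∈vertices w)

-- The edges of the star, with one constructor per direction so that consecutive steps of a walk can
-- be analysed by matching. If `c ∈ S` there would be a loop at `c`, hence the assumption `c ∉ S`
-- below.
data Spoke (S : Subset n) (c : Fin n) : Rel (Fin n) 0ℓ where
  outward : ∀ {v} → v ∈ S → Spoke S c c v
  inward  : ∀ {u} → u ∈ S → Spoke S c u c

module _ {S : Subset n} {c : Fin n} where

  spoke-sym : Symmetric (Spoke S c)
  spoke-sym (outward v∈S) = inward v∈S
  spoke-sym (inward u∈S)  = outward u∈S

  spoke? : Decidable (Spoke S c)
  spoke? u v = map′ to from ((u ≟ c ×-dec v ∈? S) ⊎-dec (u ∈? S ×-dec v ≟ c))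
    where
    to : (u ≡ c × v ∈ S) ⊎ (u ∈ S × v ≡ c) → Spoke S c u v
    to (inj₁ (refl , v∈S)) = outward v∈S
    to (inj₂ (u∈S , refl)) = inward u∈S
    from : Spoke S c u v → (u ≡ c × v ∈ S) ⊎ (u ∈ S × v ≡ c)
    from (outward v∈S) = inj₁ (refl , v∈S)
    from (inward u∈S)  = inj₂ (u∈S , refl)

  spoke⇒source∈ : ∀ {u v} → Spoke S c u v → u ∈ S ∪ ⁅ c ⁆
  spoke⇒source∈ (outward _)  = q⊆p∪q S ⁅ c ⁆ (x∈⁅x⁆ c)
  spoke⇒source∈ (inward u∈S) = p⊆p∪q ⁅ c ⁆ u∈S

  module _ (c∉S : c ∉ S) where

    -- Read in the same direction, both spokes have their centre at the same end; read in opposite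
    -- directions, they would put `c` in `S`.
    spoke-centre-unique : ∀ {c′ u v} → Spoke S c u v → Spoke S c′ u v → c ≡ c′
    spoke-centre-unique (outward _) (outward _)  = refl
    spoke-centre-unique (outward _) (inward c∈S) = contradiction c∈S c∉S
    spoke-centre-unique (inward _)  (outward c∈S) = contradiction c∈S c∉S
    spoke-centre-unique (inward _)  (inward _)   = refl

    -- A path in the star visits the centre once, so it has at most three vertices.
    spoke-path-vertices : ∀ {u v w} → u ∈ S → v ∈ S → (P : Path (Spoke S c) u v) →
                          w ∈ˡ pathVertices P → (w ≡ u ⊎ w ≡ v) ⊎ w ≡ c
    spoke-path-vertices _ _ record { walk = ε } (here w≡u) = inj₁ (inj₁ w≡u)
    spoke-path-vertices _ _ record { walk = _ ◅ _ } (here w≡u) = inj₁ (inj₁ w≡u)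
    spoke-path-vertices u∈S _ record { walk = outward _ ◅ _ } (there _) = contradiction u∈S c∉S
    spoke-path-vertices _ v∈S record { walk = inward _ ◅ ε } (there _) = contradiction v∈S c∉S
    spoke-path-vertices _ _ record { walk = inward _ ◅ inward c∈S ◅ _ } (there _) = contradiction c∈S c∉S
    spoke-path-vertices _ _ record { walk = inward _ ◅ outward _ ◅ _ } (there (here w≡c)) = inj₂ w≡c
    spoke-path-vertices _ _ record { walk = inward _ ◅ outward _ ◅ ε } (there (there (here w≡v))) =
      inj₁ (inj₂ w≡v)
    spoke-path-vertices _ _ record { walk = inward _ ◅ outward x∈S ◅ outward _ ◅ _ } (there (there _)) =
      contradiction x∈S c∉S
    spoke-path-vertices _ _ record { walk   = inward _ ◅ outward _ ◅ inward _ ◅ w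
                                   ; simple = _ ∷ (c≢ ∷ _) } (there (there _)) =
      contradiction refl (All.lookup c≢ (there (source∈vertices w)))

    spoke-connected : ∀ {u v} → u ∈ S ∪ ⁅ c ⁆ → v ∈ S ∪ ⁅ c ⁆ → Path (Spoke S c) u v
    -- Equality is settled first: the detour through `c` is a simple path only between distinct
    -- vertices.
    spoke-connected {u} {v} u∈ v∈ with u ≟ v
    ... | yes refl = record { walk = ε ; simple = [] ∷ [] }
    ... | no u≢v with x∈p∪q⁻ S ⁅ c ⁆ u∈ | x∈p∪q⁻ S ⁅ c ⁆ v∈
    ...   | inj₁ u∈S | inj₁ v∈S = record
      { walk   = inward u∈S ◅ outward v∈S ◅ ε
      ; simple = ((λ { refl → c∉S u∈S }) ∷ u≢v ∷ []) ∷ ((λ { refl → c∉S v∈S }) ∷ []) ∷ [] ∷ []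
      }
    ...   | inj₁ u∈S | inj₂ v∈c with refl ← x∈⁅y⁆⇒x≡y c v∈c =
      record { walk = inward u∈S ◅ ε ; simple = (u≢v ∷ []) ∷ [] ∷ [] }
    ...   | inj₂ u∈c | inj₁ v∈S with refl ← x∈⁅y⁆⇒x≡y c u∈c =
      record { walk = outward v∈S ◅ ε ; simple = (u≢v ∷ []) ∷ [] ∷ [] }
    ...   | inj₂ u∈c | inj₂ v∈c =
      contradiction (trans (x∈⁅y⁆⇒x≡y c u∈c) (sym (x∈⁅y⁆⇒x≡y c v∈c))) u≢v

    -- Since `c ∉ S`, steps alternate in direction. From the centre, the second step already returns
    -- to it. From `S`, the second vertex is `c`, and the closing edge would need `c` at an end of
    -- the path: at `v` it is repeated, at `u` it lies in `S`.
    spoke-acyclic : ∀ {u v} (P : Path (Spoke S c) u v) → 3 ≤ length (pathVertices P) → ¬ Spoke S c v u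
    spoke-acyclic record { walk = ε } (s≤s ())
    spoke-acyclic record { walk = _ ◅ ε } (s≤s (s≤s ()))
    spoke-acyclic record { walk = outward x∈S ◅ outward _ ◅ _ } _ _ = c∉S x∈S
    spoke-acyclic record { walk = outward _ ◅ inward _ ◅ w ; simple = c≢ ∷ _ } _ _ =
      All.lookup c≢ (there (source∈vertices w)) refl
    spoke-acyclic record { walk = inward _ ◅ inward c∈S ◅ _ } _ _ = c∉S c∈S
    spoke-acyclic record { walk = inward _ ◅ outward _ ◅ w ; simple = _ ∷ c≢ ∷ _ } _ (outward _) =
      All.lookup c≢ (target∈vertices w) refl
    spoke-acyclic record { walk = inward c∈S ◅ outward _ ◅ _ } _ (inward _) = c∉S c∈S

-- Lower bound: stars centred in the opposite part.

module _ {G : Graph n} {X Y S : Subset n} (bip : IsCompleteBipartite G X Y) where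
  open IsCompleteBipartite bip

  module _ (S⊆X : S ⊆ X) (2≤∣S∣ : 2 ≤ ∣ S ∣) where

    ∈Y⇒∉S : ∀ {y} → y ∈ Y → y ∉ S
    ∈Y⇒∉S y∈Y y∈S = disjoint (S⊆X y∈S) y∈Y

    star : ∀ {y} → y ∈ Y → Subgraph G
    star {y} y∈Y = record
      { V     = S ∪ ⁅ y ⁆
      ; E     = Spoke S y
      ; E-sym = spoke-sym
      ; E?    = spoke?
      ; E⇒Adj = λ { (outward v∈S) → Graph.sym G (complete (S⊆X v∈S) y∈Y)
                  ; (inward u∈S)  → complete (S⊆X u∈S) y∈Y }
      ; E⇒V   = spoke⇒source∈
      }

    -- Every vertex of `S` is adjacent to the centre, whose degree is therefore at least two.
    centre-not-leaf : ∀ {y} (y∈Y : y ∈ Y) → ¬ IsLeaf (star y∈Y) y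
    centre-not-leaf {y} y∈Y (_ , deg≡1) =
      contradiction (subst (2 ≤_) deg≡1 (≤-trans 2≤∣S∣ (p⊆q⇒∣p∣≤∣q∣ S⊆neighbours))) λ { (s≤s ()) }
      where
      S⊆neighbours : S ⊆ neighbours (star y∈Y) y
      S⊆neighbours {v} v∈S = lookup⇒[]= v _
        (trans (lookup∘tabulate _ v) (dec-true (spoke? y v) (outward v∈S)))

    steinerStar : ∀ {y} → y ∈ Y → SteinerTree G S
    steinerStar {y} y∈Y = record
      { tree     = star y∈Y
      ; isTree   = record
        { nonempty  = y , q⊆p∪q S ⁅ y ⁆ (x∈⁅x⁆ y)
        ; connected = spoke-connected (∈Y⇒∉S y∈Y)
        ; acyclic   = spoke-acyclic (∈Y⇒∉S y∈Y)
        }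
      ; spans    = p⊆p∪q ⁅ y ⁆
      ; leaves⊆S = leaf∈S
      }
      where
      leaf∈S : ∀ {v} → IsLeaf (star y∈Y) v → v ∈ S
      leaf∈S leaf with x∈p∪q⁻ S ⁅ y ⁆ (proj₁ leaf)
      ... | inj₁ v∈S = v∈S
      ... | inj₂ v∈y with refl ← x∈⁅y⁆⇒x≡y y v∈y = contradiction leaf (centre-not-leaf y∈Y)

    -- Each star adds to `S` only its centre, so all three conditions reduce to the centres being
    -- distinct.
    steinerStars-independent : ∀ {k} {y : Fin k → Fin n} (y∈Y : ∀ i → y i ∈ Y) → Injective _≡_ _≡_ y →
                               CompletelyIndependent (λ i → steinerStar (y∈Y i))
    steinerStars-independent {y = y} y∈Y y-inj = record
      { edgeDisjoint = λ p<q (e , e′) → distinct p<q (spoke-centre-unique (∈Y⇒∉S (y∈Y _)) e e′)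
      ; meetInS      = λ p<q → meet (distinct p<q)
      ; pathDisjoint = λ p<q u∈S v∈S _ P Q w∈P w∈Q → paths (distinct p<q)
          (spoke-path-vertices (∈Y⇒∉S (y∈Y _)) u∈S v∈S P w∈P)
          (spoke-path-vertices (∈Y⇒∉S (y∈Y _)) u∈S v∈S Q w∈Q)
      }
      where
      distinct : ∀ {p q} → p < q → y p ≢ y q
      distinct p<q eq = <⇒≢ p<q (y-inj eq)

      meet : ∀ {p q} → y p ≢ y q → (S ∪ ⁅ y p ⁆) ∩ (S ∪ ⁅ y q ⁆) ≡ S
      meet {p} {q} yp≢yq = ⊆-antisym to (λ x∈S → x∈p∩q⁺ (p⊆p∪q ⁅ y p ⁆ x∈S , p⊆p∪q ⁅ y q ⁆ x∈S))
        where
        to : (S ∪ ⁅ y p ⁆) ∩ (S ∪ ⁅ y q ⁆) ⊆ S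
        to x∈ with x∈p∩q⁻ (S ∪ ⁅ y p ⁆) (S ∪ ⁅ y q ⁆) x∈
        ... | x∈p , x∈q with x∈p∪q⁻ S ⁅ y p ⁆ x∈p | x∈p∪q⁻ S ⁅ y q ⁆ x∈q
        ...   | inj₁ x∈S | _        = x∈S
        ...   | _        | inj₁ x∈S = x∈S
        ...   | inj₂ x∈p | inj₂ x∈q =
          contradiction (trans (sym (x∈⁅y⁆⇒x≡y (y p) x∈p)) (x∈⁅y⁆⇒x≡y (y q) x∈q)) yp≢yq

      -- `A` stands for `w` being an end of the path; the other possibility is the centre, which two
      -- stars never share.
      paths : ∀ {A : Set} {p q w} → y p ≢ y q → A ⊎ w ≡ y p → A ⊎ w ≡ y q → A
      paths _     (inj₁ a)    _           = a
      paths _     _           (inj₁ a)    = a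
      paths yp≢yq (inj₂ w≡yp) (inj₂ w≡yq) = contradiction (trans (sym w≡yp) w≡yq) yp≢yq

  -- Upper bound on independent families.

  neighbour∈Y : ∀ {x y} → x ∈ X → Graph.Adj G x y → y ∈ Y
  neighbour∈Y {y = y} x∈X adj with cover y
  ... | inj₁ y∈X = contradiction adj (independentX x∈X y∈X)
  ... | inj₂ y∈Y = y∈Y

  edge-at : (T : SteinerTree G S) → ∀ {x x′} → x ∈ S → x′ ∈ S → x ≢ x′ → ∃[ y ] SteinerTree.E T x y
  edge-at T x∈S x′∈S x≢x′ with Path.walk (connected (spans x∈S) (spans x′∈S))
    where open SteinerTree T
          open IsTree isTree
  ... | ε     = contradiction refl x≢x′
  ... | e ◅ _ = _ , e

  independent-family-bound : S ⊆ X → 2 ≤ ∣ S ∣ → ∀ {j} → HasIndependentFamily G S j → j ≤ ∣ Y ∣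
  independent-family-bound S⊆X 2≤∣S∣ {j} (T , independent)
    -- The pair is fixed before the trees, so all chosen edges start at the same `x`; a repeated `y`
    -- would then be a repeated edge.
    with x , _ , x∈S , x′∈S , x≢x′ ← 2≤⇒distinct-pair {p = S} 2≤∣S∣ =
      injective-into⇒≤ y y-injective λ i → neighbour∈Y (S⊆X x∈S) (E⇒Adj (T i) (xy∈E i))
    where
    open SteinerTree
    open CompletelyIndependent independent
    y : Fin j → Fin n
    y i = proj₁ (edge-at (T i) x∈S x′∈S x≢x′)
    xy∈E : ∀ i → E (T i) x (y i)
    xy∈E i = proj₂ (edge-at (T i) x∈S x′∈S x≢x′)
    y-injective : Injective _≡_ _≡_ y
    -- `edgeDisjoint` speaks of ordered indices, so the edge of one tree is transported to the
    -- other's endpoint in either order.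
    y-injective {p} {q} yp≡yq with <-cmp p q
    ... | tri≈ _ p≡q _ = p≡q
    ... | tri< p<q _ _ = contradiction (subst (E (T p) x) yp≡yq (xy∈E p) , xy∈E q) (edgeDisjoint p<q)
    ... | tri> _ _ q<p = contradiction (subst (E (T q) x) (sym yp≡yq) (xy∈E q) , xy∈E p) (edgeDisjoint q<p)

  κ*-completeBipartite : S ⊆ X → 2 ≤ ∣ S ∣ → κ*[ G , S ]≡ ∣ Y ∣
  κ*-completeBipartite S⊆X 2≤∣S∣ = record
    { attained = _ , steinerStars-independent S⊆X 2≤∣S∣ (element∈ Y) (element-injective Y)
    ; maximal  = independent-family-bound S⊆X 2≤∣S∣
    }

-- Exchanging the parts turns the case `S ⊆ Y` into the case `S ⊆ X`.
completeBipartite-swap : {G : Graph n} {X Y : Subset n} →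
                         IsCompleteBipartite G X Y → IsCompleteBipartite G Y X
completeBipartite-swap {G = G} bip = record
  { cover        = swap ∘ cover
  ; disjoint     = λ v∈Y v∈X → disjoint v∈X v∈Y
  ; independentX = independentY
  ; independentY = independentX
  ; complete     = λ u∈Y v∈X → Graph.sym G (complete v∈X u∈Y)
  }
  where open IsCompleteBipartite bip

theorem3p1 : ∀ (m₁ m₂ : ℕ) → 2 ≤ m₁ → m₁ ≤ m₂ →
    ∀ {n} (G : Graph n) (X Y : Subset n) →
    IsCompleteBipartite G X Y → ∣ X ∣ ≡ m₁ → ∣ Y ∣ ≡ m₂ →
    ∀ (S : Subset n) → 2 ≤ ∣ S ∣ →
    (S ⊆ X → κ*[ G , S ]≡ m₂) × (S ⊆ Y → κ*[ G , S ]≡ m₁)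
theorem3p1 _ _ _ _ G X Y bip refl refl S 2≤∣S∣ =
  (λ S⊆X → κ*-completeBipartite bip S⊆X 2≤∣S∣) ,
  (λ S⊆Y → κ*-completeBipartite (completeBipartite-swap bip) S⊆Y 2≤∣S∣)
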